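{- Let $n\geqslant 12$ be an integer. Then the signed Roman domination number of the Kneser graph $K_{n,2}$ satisfies: \begin{itemize} \item if $n$ is odd, then $2\leqslant \gamma_{sR}(K_{n,2})\leqslant 3$; \item if $n$ is even, then $2\leqslant \gamma_{sR}(K_{n,2})\leqslant 5$. \end{itemize}
   Context: The Kneser graph $K_{n,2}$ is the simple graph whose vertices are all $2$-element subsets of $\{1,2,\dots,n\}$, two vertices being adjacent if and only if the corresponding sets are disjoint. Let $G=(V,E)$ be a finite simple graph and, for $v\in V$, let $N[v]=\{v\}\cup\{u\in V \mid uv\in E\}$ be the closed neighborhood of $v$. A signed Roman domination function (SRDF) on $G$ is a function $f:V\to\{ -1,1,2\}$ such that: (1) every vertex $v$ with $f(v)=-1$ has a neighbor $u$ with $f(u)=2$; and (2) for every $v\in V$, $\sum_{u\in N[v]}f(u)\geqslant 1$. The weight of $f$ is $f(V)=\sum_{v\in V}f(v)$. The signed Roman domination number $\gamma_{sR}(G)$ is the minimum weight over all SRDFs on $G$. -}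

module Defs where

open import Data.Fin.Subset using (Subset; inside; outside; ∣_∣; _∩_; Empty)
open import Data.Fin.Subset.Properties using (nonempty?; ∩-comm; ∩-idem; Empty-unique; ∣⊥∣≡0)
open import Data.Integer using (ℤ; _+_; _≤_; +_; -[1+_]; 0ℤ; +≤+)
import Data.Integer.Properties as ℤ
open import Data.List.Base using (List; []; _∷_; [_]; map; _++_; filter; foldr; cartesianProductWith)
open import Data.List.Extrema ℤ.≤-totalOrder using (argmin; argmin-all; f[argmin]≤f[xs])
open import Data.List.Membership.Propositional using (_∈_; lose)
open import Data.List.Membership.Propositional.Properties
  using (∈-map⁺; ∈-map⁻; ∈-++⁺ˡ; ∈-++⁺ʳ; ∈-filter⁺; ∈-cartesianProductWith⁺)
import Data.List.Relation.Unary.All as All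
import Data.List.Relation.Unary.All.Properties as All
import Data.List.Relation.Unary.Any as Any
open import Data.List.Relation.Unary.AllPairs using ([]; _∷_)
open import Data.List.Relation.Unary.Any using (here; there)
open import Data.List.Relation.Unary.Enumerates.Setoid using (IsEnumeration)
open import Data.List.Relation.Unary.Unique.Propositional using (Unique)
import Data.List.Relation.Unary.Unique.Propositional.Properties as Unique
open import Data.Bool.Properties using () renaming (_≟_ to _≟ᵇ_)
open import Data.Nat.Base using (ℕ; zero; suc; z≤n)
import Data.Nat.Properties as ℕ
open import Data.Product.Base using (Σ; ∃; _×_; _,_; proj₁; proj₂)
open import Data.Sum.Base using (_⊎_; inj₁; inj₂)
open import Data.Vec.Base using ([]; _∷_)
import Data.Vec.Properties as Vec
open import Function.Base using (const; _∘_)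
open import Level using (0ℓ)
open import Relation.Binary.Core using (Rel)
open import Relation.Binary.Definitions using (DecidableEquality; Decidable; Symmetric)
open import Relation.Binary.PropositionalEquality
  using (_≡_; _≗_; refl; sym; trans; cong; cong₂; subst; setoid)
open import Relation.Nullary.Decidable using (Dec; yes; no; ¬?; map′; _×-dec_; _⊎-dec_; _→-dec_)
open import Relation.Nullary.Negation using (¬_; contradiction)
import Relation.Unary as U

record FiniteSimpleGraph : Set₁ where
  field
    Vertex     : Set
    _≟_        : DecidableEquality Vertex
    vertices   : List Vertex
    enumerates : IsEnumeration (setoid Vertex) vertices
    unique     : Unique vertices
    Adj        : Rel Vertex 0ℓ
    adj?       : Decidable Adj
    adj-sym    : Symmetric Adj
    adj-irrefl : ∀ {v} → ¬ Adj v v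

  N[_] : Vertex → U.Pred Vertex 0ℓ
  N[ v ] u = u ≡ v ⊎ Adj v u

  N[_]? : ∀ v → U.Decidable N[ v ]
  N[ v ]? u = (u ≟ v) ⊎-dec adj? v u

  ∀? : ∀ {P : U.Pred Vertex 0ℓ} → U.Decidable P → Dec (∀ v → P v)
  ∀? P? = map′ (λ ps v → All.lookup ps (enumerates v)) (λ p → All.tabulate (λ {v} _ → p v))
               (All.all? P? vertices)

  ∃? : ∀ {P : U.Pred Vertex 0ℓ} → U.Decidable P → Dec (∃ P)
  ∃? P? = map′ Any.satisfied (λ (v , p) → lose (enumerates v) p) (Any.any? P? vertices)

sum : {A : Set} → (A → ℤ) → List A → ℤ
sum f = foldr (λ x s → f x + s) 0ℤ

data Label : Set where
  −1ᴸ +1ᴸ +2ᴸ : Label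

⟦_⟧ : Label → ℤ
⟦ −1ᴸ ⟧ = -[1+ 0 ]
⟦ +1ᴸ ⟧ = + 1
⟦ +2ᴸ ⟧ = + 2

_≟ᴸ_ : DecidableEquality Label
−1ᴸ ≟ᴸ −1ᴸ = yes refl
−1ᴸ ≟ᴸ +1ᴸ = no λ ()
−1ᴸ ≟ᴸ +2ᴸ = no λ ()
+1ᴸ ≟ᴸ −1ᴸ = no λ ()
+1ᴸ ≟ᴸ +1ᴸ = yes refl
+1ᴸ ≟ᴸ +2ᴸ = no λ ()
+2ᴸ ≟ᴸ −1ᴸ = no λ ()
+2ᴸ ≟ᴸ +1ᴸ = no λ ()
+2ᴸ ≟ᴸ +2ᴸ = yes refl

module _ (G : FiniteSimpleGraph) where
  open FiniteSimpleGraph G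

  closedNeighbourhoodSum : (Vertex → Label) → Vertex → ℤ
  closedNeighbourhoodSum f v = sum (⟦_⟧ ∘ f) (filter N[ v ]? vertices)

  weight : (Vertex → Label) → ℤ
  weight f = sum (⟦_⟧ ∘ f) vertices

  record IsSRDF (f : Vertex → Label) : Set where
    constructor isSRDF
    field
      defended : ∀ v → f v ≡ −1ᴸ → ∃ λ u → Adj v u × f u ≡ +2ᴸ
      positive : ∀ v → + 1 ≤ closedNeighbourhoodSum f v

  record IsSignedRomanDominationNumber (γ : ℤ) : Set where
    field
      attained   : ∃ λ f → IsSRDF f × weight f ≡ γ
      lowerBound : ∀ f → IsSRDF f → γ ≤ weight f

-- The minimum exists: a labelling is determined up to pointwise equality by
-- its values on the finitely many vertices, and the constant labelling +1 is
-- an SRDF.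

sum-cong : ∀ {A : Set} {f g : A → ℤ} → f ≗ g → sum f ≗ sum g
sum-cong f≗g []       = refl
sum-cong f≗g (x ∷ xs) = cong₂ _+_ (f≗g x) (sum-cong f≗g xs)

sum-const-nonneg : ∀ {A : Set} (xs : List A) → 0ℤ ≤ sum (const (+ 1)) xs
sum-const-nonneg []       = ℤ.≤-refl
sum-const-nonneg (x ∷ xs) = ℤ.≤-trans (+≤+ z≤n) (ℤ.+-monoʳ-≤ (+ 1) (sum-const-nonneg xs))

sum-const-positive : ∀ {A : Set} {x : A} {xs} → x ∈ xs → + 1 ≤ sum (const (+ 1)) xs
sum-const-positive {xs = _ ∷ xs} _ = ℤ.+-monoʳ-≤ (+ 1) (sum-const-nonneg xs)

labels : List Label
labels = −1ᴸ ∷ +1ᴸ ∷ +2ᴸ ∷ []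

∈-labels : ∀ ℓ → ℓ ∈ labels
∈-labels −1ᴸ = here refl
∈-labels +1ᴸ = there (here refl)
∈-labels +2ᴸ = there (there (here refl))

module _ (G : FiniteSimpleGraph) where
  open FiniteSimpleGraph G

  isSRDF? : U.Decidable (IsSRDF G)
  isSRDF? f = map′ (λ (d , p) → isSRDF d p) (λ s → IsSRDF.defended s , IsSRDF.positive s)
    (∀? (λ v → (f v ≟ᴸ −1ᴸ) →-dec ∃? (λ u → adj? v u ×-dec (f u ≟ᴸ +2ᴸ)))
     ×-dec ∀? (λ v → + 1 ℤ.≤? closedNeighbourhoodSum G f v))

  weight-cong : ∀ {f g} → f ≗ g → weight G f ≡ weight G g
  weight-cong f≗g = sum-cong (cong ⟦_⟧ ∘ f≗g) vertices

  isSRDF-resp-≗ : ∀ {f g} → f ≗ g → IsSRDF G f → IsSRDF G g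
  isSRDF-resp-≗ f≗g (isSRDF d p) = isSRDF
    (λ v gv≡−1 → let (u , adj , fu≡2) = d v (trans (f≗g v) gv≡−1)
                 in u , adj , trans (sym (f≗g u)) fu≡2)
    (λ v → subst (+ 1 ≤_) (sum-cong (cong ⟦_⟧ ∘ f≗g) (filter N[ v ]? vertices)) (p v))

  isSRDF-const : IsSRDF G (const +1ᴸ)
  isSRDF-const = isSRDF (λ _ ())
    (λ v → sum-const-positive (∈-filter⁺ N[ v ]? (enumerates v) (inj₁ refl)))

  assign : Vertex → Label → (Vertex → Label) → Vertex → Label
  assign v ℓ f u with u ≟ v
  ... | yes _ = ℓ
  ... | no  _ = f u

  labellings : List Vertex → List (Vertex → Label)
  labellings []       = [ const +1ᴸ ]
  labellings (v ∷ vs) = cartesianProductWith (assign v) labels (labellings vs)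

  labellings-complete : ∀ f vs → ∃ λ g → g ∈ labellings vs × (∀ {v} → v ∈ vs → g v ≡ f v)
  labellings-complete f []       = const +1ᴸ , here refl , λ ()
  labellings-complete f (v ∷ vs) with labellings-complete f vs
  ... | g , g∈ , g≡f = assign v (f v) g , ∈-cartesianProductWith⁺ (assign v) (∈-labels (f v)) g∈ , agree
    where
    agree : ∀ {u} → u ∈ v ∷ vs → assign v (f v) g u ≡ f u
    agree {u} u∈ with u ≟ v
    agree {u} u∈         | yes u≡v = cong f (sym u≡v)
    agree {u} (here u≡v) | no  u≢v = contradiction u≡v u≢v
    agree {u} (there u∈) | no  u≢v = g≡f u∈

  signedRomanDominationNumber : ∃ (IsSignedRomanDominationNumber G)
  signedRomanDominationNumber = weight G best , record
    { attained   = best , argmin-all (weight G) isSRDF-const (All.all-filter isSRDF? (labellings vertices)) , refl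
    ; lowerBound = λ f srdf →
        let (g , g∈ , g≡f) = labellings-complete f vertices
            g≗f            = λ v → g≡f (enumerates v)
            g∈′            = ∈-filter⁺ isSRDF? g∈ (isSRDF-resp-≗ (sym ∘ g≗f) srdf)
        in subst (weight G best ≤_) (weight-cong g≗f)
             (All.lookup (f[argmin]≤f[xs] {f = weight G} (const +1ᴸ) candidates) g∈′)
    }
    where
    candidates : List (Vertex → Label)
    candidates = filter isSRDF? (labellings vertices)

    best : Vertex → Label
    best = argmin (weight G) (const +1ᴸ) candidates

  γsR : ℤ
  γsR = proj₁ signedRomanDominationNumber

  γsR-isMinimum : IsSignedRomanDominationNumber G γsR
  γsR-isMinimum = proj₂ signedRomanDominationNumber

SubsetOfSize : ℕ → ℕ → Set
SubsetOfSize n k = Σ (Subset n) λ p → ∣ p ∣ ≡ k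

SubsetOfSize-≡ : ∀ {n k} {p q : SubsetOfSize n k} → proj₁ p ≡ proj₁ q → p ≡ q
SubsetOfSize-≡ {p = p , x} {q = .p , y} refl = cong (p ,_) (ℕ.≡-irrelevant x y)

addInside : ∀ {n k} → SubsetOfSize n k → SubsetOfSize (suc n) (suc k)
addInside (p , ∣p∣≡k) = inside ∷ p , cong suc ∣p∣≡k

addOutside : ∀ {n k} → SubsetOfSize n k → SubsetOfSize (suc n) k
addOutside (p , ∣p∣≡k) = outside ∷ p , ∣p∣≡k

subsetsOfSize : ∀ n k → List (SubsetOfSize n k)
subsetsOfSize zero    zero    = [ [] , refl ]
subsetsOfSize zero    (suc k) = []
subsetsOfSize (suc n) zero    = map addOutside (subsetsOfSize n zero)
subsetsOfSize (suc n) (suc k) = map addInside (subsetsOfSize n k) ++ map addOutside (subsetsOfSize n (suc k))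

subsetsOfSize-enumerates : ∀ n k → IsEnumeration (setoid (SubsetOfSize n k)) (subsetsOfSize n k)
subsetsOfSize-enumerates zero    zero    ([] , refl)          = here refl
subsetsOfSize-enumerates zero    (suc k) ([] , ())
subsetsOfSize-enumerates (suc n) zero    (inside  ∷ p , ())
subsetsOfSize-enumerates (suc n) zero    (outside ∷ p , eq)   =
  ∈-map⁺ addOutside (subsetsOfSize-enumerates n zero (p , eq))
subsetsOfSize-enumerates (suc n) (suc k) (inside  ∷ p , refl) =
  ∈-++⁺ˡ (∈-map⁺ addInside (subsetsOfSize-enumerates n k (p , refl)))
subsetsOfSize-enumerates (suc n) (suc k) (outside ∷ p , eq)   =
  ∈-++⁺ʳ _ (∈-map⁺ addOutside (subsetsOfSize-enumerates n (suc k) (p , eq)))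

subsetsOfSize-unique : ∀ n k → Unique (subsetsOfSize n k)
subsetsOfSize-unique zero    zero    = All.[] ∷ []
subsetsOfSize-unique zero    (suc k) = []
subsetsOfSize-unique (suc n) zero    =
  Unique.map⁺ (SubsetOfSize-≡ ∘ Vec.∷-injectiveʳ ∘ cong proj₁) (subsetsOfSize-unique n zero)
subsetsOfSize-unique (suc n) (suc k) = Unique.++⁺
  (Unique.map⁺ (SubsetOfSize-≡ ∘ Vec.∷-injectiveʳ ∘ cong proj₁) (subsetsOfSize-unique n k))
  (Unique.map⁺ (SubsetOfSize-≡ ∘ Vec.∷-injectiveʳ ∘ cong proj₁) (subsetsOfSize-unique n (suc k)))
  λ (∈ˡ , ∈ʳ) → disjoint (∈-map⁻ addInside ∈ˡ) (∈-map⁻ addOutside ∈ʳ)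
  where
  disjoint : ∀ {v} → (∃ λ p → p ∈ subsetsOfSize n k × v ≡ addInside p) →
             ¬ (∃ λ q → q ∈ subsetsOfSize n (suc k) × v ≡ addOutside q)
  disjoint (_ , _ , refl) (_ , _ , ())

Kneser₂ : ℕ → FiniteSimpleGraph
Kneser₂ n = record
  { Vertex     = SubsetOfSize n 2
  ; _≟_        = λ (p , _) (q , _) → map′ SubsetOfSize-≡ (cong proj₁) (Vec.≡-dec _≟ᵇ_ p q)
  ; vertices   = subsetsOfSize n 2
  ; enumerates = subsetsOfSize-enumerates n 2
  ; unique     = subsetsOfSize-unique n 2
  ; Adj        = λ (p , _) (q , _) → Empty (p ∩ q)
  ; adj?       = λ (p , _) (q , _) → ¬? (nonempty? (p ∩ q))
  ; adj-sym    = λ { {p , _} {q , _} → subst Empty (∩-comm p q) }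
  ; adj-irrefl = λ { {p , ∣p∣≡2} p∩p≡∅ → contradiction
      (trans (sym ∣p∣≡2) (trans (cong ∣_∣ (Empty-unique (subst Empty (∩-idem p) p∩p≡∅))) (∣⊥∣≡0 n)))
      λ () }
  }

{-# OPTIONS --safe #-}

-- Vertices of K(n,2) are edges of the complete graph on n points, and two of
-- them satisfy [u ∈ N[v]] = 1 − |u ∩ v| + 2[u = v].  Hence a closed neighbourhood
-- sum is W − Σ_u |u ∩ v| f(u) + 2 f(v), W being the weight.
--
-- Lower bound: summing the condition at v over all v gives |N| W ≥ |V|, where
-- |N| = |V| − 2n + 4 < |V|, so W > 1.
--
-- Upper bound: take a point set B and a cycle H inside B, put 2 on the edges of
-- H, −1 on the edges between B and its complement, and 1 elsewhere; that
-- is, f(q) = (−1)^|q ∩ B| + [q ∈ H].  With c = n − 2|B| the sums of the first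
-- summand are explicit.  An m-cycle covering B with n = 2m + 3 (so c = 3), or
-- covering all but one point of B with n = 2m + 6 (so c = 4), gives W = 2c − 3
-- and closed neighbourhood sums at least 1.
module Submission where

open import Defs
open import Data.Bool.Base using (_∧_)
open import Data.Fin.Subset using (Side; Subset; inside; outside; ∣_∣; _∩_; _⊆_; Empty; ⊥)
open import Data.Fin.Subset.Properties
  using (∣⊥∣≡0; ∣p∩q∣≤∣p∣; p∩q⊆p; p∩q⊆q; Empty-unique; ∩-comm; ∩-idem; ∩-zeroˡ; ∩-zeroʳ;
         x∈p⇒∣p-x∣<∣p∣; p⊂q⇒∣p∣<∣q∣; ⊆-antisym)
  renaming (_∈?_ to _∈ˢ?_)
open import Data.Integer
  using (ℤ; NonNegative; nonNegative; +_; -1ℤ; 0ℤ; 1ℤ; +≤+; +<+; _+_; _-_; _*_; _^_; _≤_; _<_)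
import Data.Integer.Properties as ℤ
open import Algebra.Properties.AbelianGroup ℤ.+-0-abelianGroup
  using () renaming (∙-cancelʳ to +-cancelʳ)
open import Data.Integer.Tactic.RingSolver using (solve-∀)
open import Data.List.Base using (List; []; _∷_; map; _++_; filter; length)
import Data.List.Membership.DecPropositional as DecMembership
open import Data.List.Membership.Propositional using (_∈_)
open import Data.List.Properties using (length-map)
open import Data.List.Relation.Unary.All as All using (All; []; _∷_)
import Data.List.Relation.Unary.All.Properties as All
open import Data.List.Relation.Unary.AllPairs using ([]; _∷_)
open import Data.List.Relation.Unary.Any using (here; there)
open import Data.List.Relation.Unary.Unique.Propositional using (Unique)
import Data.List.Relation.Unary.Unique.Propositional.Properties as Unique
open import Data.Nat as ℕ using (ℕ; zero; suc; s≤s; z≤n)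
open import Data.Nat.Divisibility using (_∣_; _∤_; divides)
import Data.Nat.Properties as ℕ
import Data.Nat.Tactic.RingSolver as ℕ-Solver
open import Data.Product using (∃; _×_; _,_; proj₁; proj₂)
open import Data.Sum using (_⊎_; inj₁; inj₂)
open import Data.Vec.Base as Vec using ([]; _∷_)
import Data.Vec.Properties as Vec
open import Function.Base using (const; _∘_)
open import Relation.Binary.Definitions using (DecidableEquality)
open import Relation.Binary.PropositionalEquality
open import Relation.Nullary using (Dec; yes; no; ¬_; contradiction)
import Relation.Unary as U

-- Sums over lists

private variable
  A C : Set

sum-+ : ∀ (f g : A → ℤ) xs → sum (λ x → f x + g x) xs ≡ sum f xs + sum g xs
sum-+ f g []       = refl
sum-+ f g (x ∷ xs) = trans (cong (λ s → f x + g x + s) (sum-+ f g xs)) (interchange (f x) (g x) _ _)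
  where
  interchange : ∀ a b c d → a + b + (c + d) ≡ a + c + (b + d)
  interchange = solve-∀

sum-*ˡ : ∀ c (f : A → ℤ) xs → sum (λ x → c * f x) xs ≡ c * sum f xs
sum-*ˡ c f []       = sym (ℤ.*-zeroʳ c)
sum-*ˡ c f (x ∷ xs) = trans (cong (λ s → c * f x + s) (sum-*ˡ c f xs)) (sym (ℤ.*-distribˡ-+ c (f x) _))

sum-*ʳ : ∀ c (f : A → ℤ) xs → sum (λ x → f x * c) xs ≡ sum f xs * c
sum-*ʳ c f []       = refl
sum-*ʳ c f (x ∷ xs) = trans (cong (λ s → f x * c + s) (sum-*ʳ c f xs)) (sym (ℤ.*-distribʳ-+ c (f x) _))

sum-++ : ∀ (f : A → ℤ) xs ys → sum f (xs ++ ys) ≡ sum f xs + sum f ys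
sum-++ f []       ys = sym (ℤ.+-identityˡ _)
sum-++ f (x ∷ xs) ys = trans (cong (λ s → f x + s) (sum-++ f xs ys)) (sym (ℤ.+-assoc (f x) _ _))

sum-map : ∀ (f : C → ℤ) (h : A → C) xs → sum f (map h xs) ≡ sum (f ∘ h) xs
sum-map f h []       = refl
sum-map f h (x ∷ xs) = cong (λ s → f (h x) + s) (sum-map f h xs)

sum-0 : ∀ (xs : List A) → sum (const 0ℤ) xs ≡ 0ℤ
sum-0 []       = refl
sum-0 (x ∷ xs) = trans (ℤ.+-identityˡ _) (sum-0 xs)

sum-swap : ∀ (f : A → C → ℤ) xs ys →
           sum (λ x → sum (f x) ys) xs ≡ sum (λ y → sum (λ x → f x y) xs) ys
sum-swap f []       ys = sym (sum-0 ys)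
sum-swap f (x ∷ xs) ys = trans (cong (λ s → sum (f x) ys + s) (sum-swap f xs ys)) (sym (sum-+ (f x) _ ys))

sum-mono-≤ : ∀ {f g : A → ℤ} → (∀ x → f x ≤ g x) → ∀ xs → sum f xs ≤ sum g xs
sum-mono-≤ f≤g []       = ℤ.≤-refl
sum-mono-≤ f≤g (x ∷ xs) = ℤ.+-mono-≤ (f≤g x) (sum-mono-≤ f≤g xs)

sum-cong-All : ∀ {f g : A → ℤ} {xs} → All (λ x → f x ≡ g x) xs → sum f xs ≡ sum g xs
sum-cong-All []       = refl
sum-cong-All (p ∷ ps) = cong₂ _+_ p (sum-cong-All ps)

sum-const-1 : ∀ (xs : List A) → sum (const 1ℤ) xs ≡ + length xs
sum-const-1 []       = refl
sum-const-1 (x ∷ xs) = cong (λ s → 1ℤ + s) (sum-const-1 xs)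

-- Indicators and sums over subfamilies

𝟙 : Dec A → ℤ
𝟙 (yes _) = 1ℤ
𝟙 (no  _) = 0ℤ

𝟙-yes : (a? : Dec A) → A → 𝟙 a? ≡ 1ℤ
𝟙-yes (yes _) a = refl
𝟙-yes (no ¬a) a = contradiction a ¬a

𝟙-no : (a? : Dec A) → ¬ A → 𝟙 a? ≡ 0ℤ
𝟙-no (yes a) ¬a = contradiction a ¬a
𝟙-no (no _)  ¬a = refl

𝟙-cong : (A → C) → (C → A) → (a? : Dec A) (c? : Dec C) → 𝟙 a? ≡ 𝟙 c?
𝟙-cong to from (yes a) c? = sym (𝟙-yes c? (to a))
𝟙-cong to from (no ¬a) c? = sym (𝟙-no c? (¬a ∘ from))

sum-filter : ∀ {P : U.Pred A _} (P? : U.Decidable P) (f : A → ℤ) xs →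
             sum f (filter P? xs) ≡ sum (λ x → f x * 𝟙 (P? x)) xs
sum-filter P? f []       = refl
sum-filter P? f (x ∷ xs) with P? x
... | yes _ = cong₂ _+_ (sym (ℤ.*-identityʳ (f x))) (sum-filter P? f xs)
... | no  _ = trans (sum-filter P? f xs)
                (sym (trans (cong (λ z → z + _) (ℤ.*-zeroʳ (f x))) (ℤ.+-identityˡ _)))

module _ (_≟_ : DecidableEquality A) where

  sum-≟ : ∀ (f : A → ℤ) {v xs} → Unique xs → v ∈ xs → sum (λ u → f u * 𝟙 (u ≟ v)) xs ≡ f v
  sum-≟ f {xs = x ∷ xs} (x∉xs ∷ _) (here refl) = trans
    (cong₂ _+_ (trans (cong (f x *_) (𝟙-yes (x ≟ x) refl)) (ℤ.*-identityʳ (f x)))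
               (trans (sum-cong-All (All.map vanish x∉xs)) (sum-0 xs)))
    (ℤ.+-identityʳ (f x))
    where
    vanish : ∀ {u} → x ≢ u → f u * 𝟙 (u ≟ x) ≡ 0ℤ
    vanish {u} x≢u = trans (cong (f u *_) (𝟙-no (u ≟ x) (x≢u ∘ sym))) (ℤ.*-zeroʳ (f u))
  sum-≟ f {v} {x ∷ xs} (x∉xs ∷ uxs) (there v∈xs) = trans
    (cong₂ _+_ (trans (cong (f x *_) (𝟙-no (x ≟ v) (All.lookup x∉xs v∈xs))) (ℤ.*-zeroʳ (f x)))
               (sum-≟ f uxs v∈xs))
    (ℤ.+-identityˡ (f v))

  open DecMembership _≟_ using (_∈?_)

  -- Induction on `H`: as `h` does not recur in the tail, the indicator of `h ∷ H` is the sum of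
  -- those of `h` and of `H`, and `sum-≟` evaluates the former.
  sum-∈ : ∀ (f : A → ℤ) {vs} → Unique vs → (∀ v → v ∈ vs) → ∀ {H} → Unique H →
          sum (λ u → f u * 𝟙 (u ∈? H)) vs ≡ sum f H
  sum-∈ f {vs} uvs all {[]} [] = trans
    (sum-cong (λ u → ℤ.*-zeroʳ (f u)) vs) (sum-0 vs)
  sum-∈ f {vs} uvs all {h ∷ H} (h∉H ∷ uH) = trans
    (trans (sum-cong split vs) (sum-+ (λ u → f u * 𝟙 (u ≟ h)) (λ u → f u * 𝟙 (u ∈? H)) vs))
    (cong₂ _+_ (sum-≟ f uvs (all h)) (sum-∈ f uvs all uH))
    where
    +-*0ʳ : ∀ a → a * 1ℤ ≡ a * 1ℤ + a * 0ℤ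
    +-*0ʳ = solve-∀
    +-*0ˡ : ∀ a → a * 1ℤ ≡ a * 0ℤ + a * 1ℤ
    +-*0ˡ = solve-∀
    0+0 : ∀ a → a * 0ℤ ≡ a * 0ℤ + a * 0ℤ
    0+0 = solve-∀
    split : ∀ u → f u * 𝟙 (u ∈? h ∷ H) ≡ f u * 𝟙 (u ≟ h) + f u * 𝟙 (u ∈? H)
    split u with u ≟ h | u ∈? H
    ... | yes refl | yes u∈H = contradiction refl (All.lookup h∉H u∈H)
    ... | yes refl | no  _   = +-*0ʳ (f u)
    ... | no  u≢h  | yes u∈H = +-*0ˡ (f u)
    ... | no  u≢h  | no  _   = 0+0 (f u)

-- Double counting in regular graphs

module _ (G : FiniteSimpleGraph) where
  open FiniteSimpleGraph G

  N-sym : ∀ {u v} → N[ v ] u → N[ u ] v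
  N-sym (inj₁ u≡v) = inj₁ (sym u≡v)
  N-sym (inj₂ adj) = inj₂ (adj-sym adj)

  -- By double counting, the closed neighbourhood sums of f add up to d * weight f.
  regular-weight-bound : ∀ d → (∀ v → closedNeighbourhoodSum G (const +1ᴸ) v ≡ d) →
    Vertex → d < weight G (const +1ᴸ) → ∀ f → IsSRDF G f → + 2 ≤ weight G f
  regular-weight-bound d reg v₀ d<∣V∣ f srdf = ℤ.i<j⇒suc[i]≤j (ℤ.≰⇒> λ W≤1 → ℤ.<⇒≱ d<∣V∣
    (begin
      weight G (const +1ᴸ)                             ≤⟨ sum-mono-≤ (IsSRDF.positive srdf) vertices ⟩
      sum (closedNeighbourhoodSum G f) vertices        ≡⟨ double-count ⟩
      d * weight G f                                   ≤⟨ ℤ.*-monoˡ-≤-nonNeg d {{d-nonNeg}} W≤1 ⟩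
      d * 1ℤ                                           ≡⟨ ℤ.*-identityʳ d ⟩
      d                                                ∎))
    where
    open ℤ.≤-Reasoning
    g : Vertex → ℤ
    g = ⟦_⟧ ∘ f
    -- Multiplying `W≤1` by `d` requires 0 ≤ d; at `v₀`, `d` counts a closed neighbourhood.
    d-nonNeg : NonNegative d
    d-nonNeg = nonNegative (subst (0ℤ ≤_) (reg v₀) (sum-const-nonneg (filter N[ v₀ ]? vertices)))
    -- The factor `1ℤ` is the constant function as `sum-filter` produces it, so that `reg u` applies
    -- afterwards.
    swap : ∀ u v → g u * 𝟙 (N[ v ]? u) ≡ g u * (1ℤ * 𝟙 (N[ u ]? v))
    swap u v = cong (g u *_) (trans (𝟙-cong N-sym N-sym (N[ v ]? u) (N[ u ]? v)) (sym (ℤ.*-identityˡ _)))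
    double-count : sum (closedNeighbourhoodSum G f) vertices ≡ d * weight G f
    double-count = begin-equality
      sum (closedNeighbourhoodSum G f) vertices
        ≡⟨ sum-cong (λ v → sum-filter N[ v ]? g vertices) vertices ⟩
      sum (λ v → sum (λ u → g u * 𝟙 (N[ v ]? u)) vertices) vertices
        ≡⟨ sum-swap (λ v u → g u * 𝟙 (N[ v ]? u)) vertices vertices ⟩
      sum (λ u → sum (λ v → g u * 𝟙 (N[ v ]? u)) vertices) vertices
        ≡⟨ sum-cong (λ u → trans (sum-cong (swap u) vertices)
             (trans (sum-*ˡ (g u) _ vertices) (cong (g u *_)
               (trans (sym (sum-filter N[ u ]? (const 1ℤ) vertices)) (reg u))))) vertices ⟩
      sum (λ u → g u * d) vertices
        ≡⟨ trans (sum-*ʳ d g vertices) (ℤ.*-comm _ d) ⟩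
      d * weight G f ∎

  γsR-≥ : ∀ {k} → (∀ f → IsSRDF G f → k ≤ weight G f) → k ≤ γsR G
  γsR-≥ {k} bound with IsSignedRomanDominationNumber.attained (γsR-isMinimum G)
  ... | f , srdf , W≡γ = subst (k ≤_) W≡γ (bound f srdf)

  γsR-≤ : ∀ {k} → (∃ λ f → IsSRDF G f × weight G f ≡ k) → γsR G ≤ k
  γsR-≤ (f , srdf , W≡k) = subst (γsR G ≤_) W≡k
    (IsSignedRomanDominationNumber.lowerBound (γsR-isMinimum G) f srdf)

-- Sums over subsets of given size

-- The summand sees only the subset, not the proof of its size, so an induction on the points can
-- prepend a point freely.
∑ : ∀ n k → (Subset n → ℤ) → ℤ
∑ n k g = sum (g ∘ proj₁) (subsetsOfSize n k)

∑-cong : ∀ {n k} {g h : Subset n → ℤ} → (∀ p → g p ≡ h p) → ∑ n k g ≡ ∑ n k h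
∑-cong {n} {k} g≗h = sum-cong (g≗h ∘ proj₁) (subsetsOfSize n k)

∑-+ : ∀ {n k} (g h : Subset n → ℤ) → ∑ n k (λ p → g p + h p) ≡ ∑ n k g + ∑ n k h
∑-+ {n} {k} g h = sum-+ (g ∘ proj₁) (h ∘ proj₁) (subsetsOfSize n k)

∑-*ˡ : ∀ {n k} c (g : Subset n → ℤ) → ∑ n k (λ p → c * g p) ≡ c * ∑ n k g
∑-*ˡ {n} {k} c g = sum-*ˡ c (g ∘ proj₁) (subsetsOfSize n k)

∑-zero : ∀ n (g : Subset n → ℤ) → ∑ n 0 g ≡ g ⊥
∑-zero zero    g = ℤ.+-identityʳ (g [])
∑-zero (suc n) g = trans (sum-map (g ∘ proj₁) addOutside (subsetsOfSize n 0)) (∑-zero n (g ∘ (outside ∷_)))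

∑-suc : ∀ n k (g : Subset (suc n) → ℤ) →
        ∑ (suc n) (suc k) g ≡ ∑ n k (g ∘ (inside ∷_)) + ∑ n (suc k) (g ∘ (outside ∷_))
∑-suc n k g = trans (sum-++ (g ∘ proj₁) (map addInside (subsetsOfSize n k)) _)
  (cong₂ _+_ (sum-map (g ∘ proj₁) addInside (subsetsOfSize n k))
             (sum-map (g ∘ proj₁) addOutside (subsetsOfSize n (suc k))))

-- Signs of points and sums of products of signs

κ : Side → ℤ
κ inside  = 1ℤ
κ outside = 0ℤ

-- The sign of a point, -1 inside and 1 outside, written linearly in `κ b` to suit ring identities.
ε : Side → ℤ
ε b = 1ℤ - + 2 * κ b

-- The product of the signs of the points of `q`. Its sums over k-subsets are the elementary
-- symmetric polynomials in the signs.
χ : ∀ {n} → Subset n → Subset n → ℤ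
χ B q = -1ℤ ^ ∣ q ∩ B ∣

-- The sum of (−1)^[i ∈ B] over all points i, respectively over i ∈ p.
bias : ∀ {n} → Subset n → ℤ
bias {n} B = + n - + 2 * + ∣ B ∣

biasOn : ∀ {n} → Subset n → Subset n → ℤ
biasOn B p = + ∣ p ∣ - + 2 * + ∣ p ∩ B ∣

∣∷∣ : ∀ {n} x (p : Subset n) → + ∣ x ∷ p ∣ ≡ κ x + + ∣ p ∣
∣∷∣ inside  p = refl
∣∷∣ outside p = refl

κ-∧ : ∀ x b → κ (x ∧ b) ≡ κ x * κ b
κ-∧ inside  inside  = refl
κ-∧ inside  outside = refl
κ-∧ outside b       = refl

ε² : ∀ b → ε b * ε b ≡ 1ℤ
ε² inside  = refl
ε² outside = refl

-1^∣∷∣ : ∀ {n} b (r : Subset n) → -1ℤ ^ ∣ b ∷ r ∣ ≡ ε b * -1ℤ ^ ∣ r ∣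
-1^∣∷∣ inside  r = refl
-1^∣∷∣ outside r = sym (ℤ.*-identityˡ _)

∣⊥∩p∣≡0 : ∀ {n} (p : Subset n) → ∣ ⊥ ∩ p ∣ ≡ 0
∣⊥∩p∣≡0 {n} p = trans (cong ∣_∣ (∩-zeroˡ p)) (∣⊥∣≡0 n)

χ-⊥ : ∀ {n} (B : Subset n) → χ B ⊥ ≡ 1ℤ
χ-⊥ B = cong (-1ℤ ^_) (∣⊥∩p∣≡0 B)

bias-∷ : ∀ {n} b (B : Subset n) → bias (b ∷ B) ≡ ε b + bias B
bias-∷ {n} b B = trans (cong (λ z → + suc n - + 2 * z) (∣∷∣ b B)) (regroup (+ n) (κ b) (+ ∣ B ∣))
  where
  regroup : ∀ m k s → 1ℤ + m - + 2 * (k + s) ≡ 1ℤ - + 2 * k + (m - + 2 * s)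
  regroup = solve-∀

biasOn-∷ : ∀ {n} b (B : Subset n) x p → biasOn (b ∷ B) (x ∷ p) ≡ κ x * ε b + biasOn B p
biasOn-∷ b B x p = trans
  (cong₂ (λ y z → y - + 2 * z) (∣∷∣ x p)
    (trans (∣∷∣ (x ∧ b) (p ∩ B)) (cong (λ z → z + + ∣ p ∩ B ∣) (κ-∧ x b))))
  (regroup (κ x) (κ b) (+ ∣ p ∣) (+ ∣ p ∩ B ∣))
  where
  regroup : ∀ k l s t → k + s - + 2 * (k * l + t) ≡ k * (1ℤ - + 2 * l) + (s - + 2 * t)
  regroup = solve-∀

∑₁χ : ∀ {n} (B : Subset n) → ∑ n 1 (χ B) ≡ bias B
∑₁χ {zero}  []      = refl
∑₁χ {suc n} (b ∷ B) = begin
  ∑ (suc n) 1 (χ (b ∷ B))                           ≡⟨ ∑-suc n 0 (χ (b ∷ B)) ⟩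
  ∑ n 0 (χ (b ∷ B) ∘ (inside ∷_)) + ∑ n 1 (χ B)     ≡⟨ cong₂ _+_ head (∑₁χ B) ⟩
  ε b + bias B                                      ≡⟨ bias-∷ b B ⟨
  bias (b ∷ B)                                      ∎
  where
  open ≡-Reasoning
  head : ∑ n 0 (χ (b ∷ B) ∘ (inside ∷_)) ≡ ε b
  head = trans (∑-zero n (χ (b ∷ B) ∘ (inside ∷_))) (trans (-1^∣∷∣ b (⊥ ∩ B)) (trans (cong (ε b *_) (χ-⊥ B)) (ℤ.*-identityʳ (ε b))))

∑₁∩χ : ∀ {n} (B p : Subset n) → ∑ n 1 (λ q → + ∣ q ∩ p ∣ * χ B q) ≡ biasOn B p
∑₁∩χ {zero}  []      []      = refl
∑₁∩χ {suc n} (b ∷ B) (x ∷ p) = begin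
  ∑ (suc n) 1 g                                      ≡⟨ ∑-suc n 0 g ⟩
  ∑ n 0 (g ∘ (inside ∷_)) + ∑ n 1 (g ∘ (outside ∷_)) ≡⟨ cong₂ _+_ head (∑₁∩χ B p) ⟩
  κ x * ε b + biasOn B p                             ≡⟨ biasOn-∷ b B x p ⟨
  biasOn (b ∷ B) (x ∷ p)                             ∎
  where
  open ≡-Reasoning
  g : Subset (suc n) → ℤ
  g q = + ∣ q ∩ (x ∷ p) ∣ * χ (b ∷ B) q
  head : ∑ n 0 (g ∘ (inside ∷_)) ≡ κ x * ε b
  head = trans (∑-zero n (g ∘ (inside ∷_))) (cong₂ _*_
    (trans (∣∷∣ x (⊥ ∩ p)) (trans (cong (λ z → κ x + + z) (∣⊥∩p∣≡0 p)) (ℤ.+-identityʳ (κ x))))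
    (trans (-1^∣∷∣ b (⊥ ∩ B)) (trans (cong (ε b *_) (χ-⊥ B)) (ℤ.*-identityʳ (ε b)))))

-- With signs s_i this is 2 e₂ + Σ s_i² = (Σ s_i)², where each s_i² is 1. The doubled form avoids a
-- division.
∑₂χ : ∀ {n} (B : Subset n) → + 2 * ∑ n 2 (χ B) + + n ≡ bias B * bias B
∑₂χ {zero}  []      = refl
∑₂χ {suc n} (b ∷ B) = begin
  + 2 * ∑ (suc n) 2 (χ (b ∷ B)) + + suc n
    ≡⟨ cong (λ z → + 2 * z + + suc n) (∑-suc n 1 (χ (b ∷ B))) ⟩
  + 2 * (∑ n 1 (χ (b ∷ B) ∘ (inside ∷_)) + K) + + suc n
    ≡⟨ cong (λ z → + 2 * (z + K) + + suc n) head ⟩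
  + 2 * (e * β + K) + (1ℤ + + n)
    ≡⟨ cong (λ z → + 2 * (e * β + K) + (z + + n)) (ε² b) ⟨
  + 2 * (e * β + K) + (e * e + + n)
    ≡⟨ regroup e β K (+ n) ⟩
  e * e + + 2 * (e * β) + (+ 2 * K + + n)
    ≡⟨ cong (λ z → e * e + + 2 * (e * β) + z) (∑₂χ B) ⟩
  e * e + + 2 * (e * β) + β * β
    ≡⟨ square e β ⟩
  (e + β) * (e + β)
    ≡⟨ cong (λ z → z * z) (bias-∷ b B) ⟨
  bias (b ∷ B) * bias (b ∷ B) ∎
  where
  open ≡-Reasoning
  K e β : ℤ
  K = ∑ n 2 (χ B)
  e = ε b
  β = bias B
  head : ∑ n 1 (χ (b ∷ B) ∘ (inside ∷_)) ≡ e * β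
  head = trans (∑-cong {n} {1} (λ q → -1^∣∷∣ b (q ∩ B)))
           (trans (∑-*ˡ {n} {1} e (χ B)) (cong (e *_) (∑₁χ B)))
  regroup : ∀ e β K n → + 2 * (e * β + K) + (e * e + n) ≡ e * e + + 2 * (e * β) + (+ 2 * K + n)
  regroup = solve-∀
  square : ∀ e β → e * e + + 2 * (e * β) + β * β ≡ (e + β) * (e + β)
  square = solve-∀

-- Each i in `p` contributes s_i times the sum of the other signs, which is s_i * `bias B` - 1
-- because s_i² = 1.
∑₂∩χ : ∀ {n} (B p : Subset n) →
       ∑ n 2 (λ q → + ∣ q ∩ p ∣ * χ B q) ≡ bias B * biasOn B p - + ∣ p ∣
∑₂∩χ {zero}  []      []      = refl
∑₂∩χ {suc n} (b ∷ B) (x ∷ p) = begin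
  ∑ (suc n) 2 g
    ≡⟨ ∑-suc n 1 g ⟩
  ∑ n 1 (g ∘ (inside ∷_)) + ∑ n 2 (g ∘ (outside ∷_))
    ≡⟨ cong₂ _+_ head (∑₂∩χ B p) ⟩
  k * e * β + e * σ + (β * σ - s)
    ≡⟨ regroup k e β σ s ⟩
  (e + β) * (k * e + σ) - (k * (e * e) + s)
    ≡⟨ cong (λ z → (e + β) * (k * e + σ) - (z + s)) (trans (cong (k *_) (ε² b)) (ℤ.*-identityʳ k)) ⟩
  (e + β) * (k * e + σ) - (k + s)
    ≡⟨ cong₂ _-_ (cong₂ _*_ (bias-∷ b B) (biasOn-∷ b B x p)) (∣∷∣ x p) ⟨
  bias (b ∷ B) * biasOn (b ∷ B) (x ∷ p) - + ∣ x ∷ p ∣ ∎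
  where
  open ≡-Reasoning
  g : Subset (suc n) → ℤ
  g q = + ∣ q ∩ (x ∷ p) ∣ * χ (b ∷ B) q
  k e β σ s : ℤ
  k = κ x
  e = ε b
  β = bias B
  σ = biasOn B p
  s = + ∣ p ∣
  expand : ∀ k e c t → (k + t) * (e * c) ≡ k * e * c + e * (t * c)
  expand = solve-∀
  head : ∑ n 1 (g ∘ (inside ∷_)) ≡ k * e * β + e * σ
  head = trans (∑-cong {n} {1} (λ q → trans (cong₂ _*_ (∣∷∣ x (q ∩ p)) (-1^∣∷∣ b (q ∩ B)))
                                  (expand k e (χ B q) (+ ∣ q ∩ p ∣))))
    (trans (∑-+ {n} {1} (λ q → k * e * χ B q) (λ q → e * (+ ∣ q ∩ p ∣ * χ B q)))
      (cong₂ _+_ (trans (∑-*ˡ {n} {1} (k * e) (χ B)) (cong (k * e *_) (∑₁χ B)))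
                 (trans (∑-*ˡ {n} {1} e (λ q → + ∣ q ∩ p ∣ * χ B q)) (cong (e *_) (∑₁∩χ B p)))))
  regroup : ∀ k e β σ s →
    k * e * β + e * σ + (β * σ - s) ≡ (e + β) * (k * e + σ) - (k * (e * e) + s)
  regroup = solve-∀

-- The Kneser graph

Empty⇒∣∣≡0 : ∀ {n} {p : Subset n} → Empty p → ∣ p ∣ ≡ 0
Empty⇒∣∣≡0 {n} e = trans (cong ∣_∣ (Empty-unique e)) (∣⊥∣≡0 n)

∣∣≡0⇒Empty : ∀ {n} {p : Subset n} → ∣ p ∣ ≡ 0 → Empty p
∣∣≡0⇒Empty {p = p} ∣p∣≡0 (x , x∈p) = ℕ.m<n⇒n≢0 (x∈p⇒∣p-x∣<∣p∣ x∈p) ∣p∣≡0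

⊆∧∣∣≡⇒≡ : ∀ {n} {p q : Subset n} → p ⊆ q → ∣ p ∣ ≡ ∣ q ∣ → p ≡ q
⊆∧∣∣≡⇒≡ {p = p} {q} p⊆q ∣p∣≡∣q∣ = ⊆-antisym p⊆q q⊆p
  where
  q⊆p : q ⊆ p
  q⊆p {x} x∈q with x ∈ˢ? p
  ... | yes x∈p = x∈p
  ... | no  x∉p = contradiction ∣p∣≡∣q∣ (ℕ.<⇒≢ (p⊂q⇒∣p∣<∣q∣ (p⊆q , x , x∈q , x∉p)))

module _ {n : ℕ} where
  open FiniteSimpleGraph (Kneser₂ n)

  -- An empty intersection would make the vertices adjacent, and one of size 2 would equal both of
  -- them.
  meeting : ∀ {u v : Vertex} → u ≢ v → ¬ Adj v u → ∣ proj₁ u ∩ proj₁ v ∣ ≡ 1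
  meeting {p , ∣p∣≡2} {q , ∣q∣≡2} p≢q meet with ∣ p ∩ q ∣ in eq
  ... | 0 = contradiction (subst Empty (∩-comm p q) (∣∣≡0⇒Empty eq)) meet
  ... | 1 = refl
  ... | 2 = contradiction (SubsetOfSize-≡ (trans (sym (⊆∧∣∣≡⇒≡ (p∩q⊆p p q) (trans eq (sym ∣p∣≡2))))
                                                 (⊆∧∣∣≡⇒≡ (p∩q⊆q p q) (trans eq (sym ∣q∣≡2))))) p≢q
  ... | suc (suc (suc k)) = contradiction (subst₂ ℕ._≤_ eq ∣p∣≡2 (∣p∩q∣≤∣p∣ p q)) λ { (s≤s (s≤s ())) }

  -- The intersection has size 2, 0 or 1 according as u = v, u and v are adjacent, or neither; the
  -- right side is then 1, 1 or 0.
  𝟙-N : ∀ v u → 𝟙 (N[ v ]? u) ≡ 1ℤ - + ∣ proj₁ u ∩ proj₁ v ∣ + + 2 * 𝟙 (u ≟ v)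
  𝟙-N v u = by-cases (u ≟ v) (adj? v u)
    where
    by-cases : (eq? : Dec (u ≡ v)) → Dec (Adj v u) →
               𝟙 (N[ v ]? u) ≡ 1ℤ - + ∣ proj₁ u ∩ proj₁ v ∣ + + 2 * 𝟙 eq?
    by-cases (yes refl) _ = trans (𝟙-yes (N[ v ]? v) (inj₁ refl))
      (sym (cong (λ m → 1ℤ - + m + + 2) (trans (cong ∣_∣ (∩-idem (proj₁ v))) (proj₂ v))))
    by-cases (no _) (yes adj) = trans (𝟙-yes (N[ v ]? u) (inj₂ adj))
      (sym (cong (λ m → 1ℤ - + m + 0ℤ) (Empty⇒∣∣≡0 (subst Empty (∩-comm (proj₁ v) (proj₁ u)) adj))))
    by-cases (no u≢v) (no ¬adj) = trans (𝟙-no (N[ v ]? u) λ { (inj₁ u≡v) → u≢v u≡v ; (inj₂ adj) → ¬adj adj })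
      (sym (cong (λ m → 1ℤ - + m + 0ℤ) (meeting u≢v ¬adj)))

  -- Multiply `𝟙-N` by the label of u and sum over u; `sum-≟` collapses the diagonal term.
  closedNeighbourhoodSum-Kneser : ∀ f v → closedNeighbourhoodSum (Kneser₂ n) f v ≡
    weight (Kneser₂ n) f - sum (λ u → + ∣ proj₁ u ∩ proj₁ v ∣ * ⟦ f u ⟧) vertices + + 2 * ⟦ f v ⟧
  closedNeighbourhoodSum-Kneser f v = begin
    closedNeighbourhoodSum (Kneser₂ n) f v
      ≡⟨ sum-filter N[ v ]? g vertices ⟩
    sum (λ u → g u * 𝟙 (N[ v ]? u)) vertices
      ≡⟨ sum-cong (λ u → trans (cong (g u *_) (𝟙-N v u)) (expand (g u) (+ ∣ proj₁ u ∩ proj₁ v ∣) (𝟙 (u ≟ v)))) vertices ⟩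
    sum (λ u → g u + -1ℤ * m u + + 2 * δ u) vertices
      ≡⟨ sum-+ (λ u → g u + -1ℤ * m u) (λ u → + 2 * δ u) vertices ⟩
    sum (λ u → g u + -1ℤ * m u) vertices + sum (λ u → + 2 * δ u) vertices
      ≡⟨ cong₂ _+_ (trans (sum-+ g (λ u → -1ℤ * m u) vertices)
                     (cong (λ z → sum g vertices + z) (trans (sum-*ˡ -1ℤ m vertices) (ℤ.-1*i≡-i _))))
                   (trans (sum-*ˡ (+ 2) δ vertices)
                     (cong (+ 2 *_) (sum-≟ _≟_ g unique (enumerates v)))) ⟩
    weight (Kneser₂ n) f - sum m vertices + + 2 * g v ∎
    where
    open ≡-Reasoning
    g m δ : Vertex → ℤ
    g = ⟦_⟧ ∘ f
    m u = + ∣ proj₁ u ∩ proj₁ v ∣ * g u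
    δ u = g u * 𝟙 (u ≟ v)
    expand : ∀ a i d → a * (1ℤ - i + + 2 * d) ≡ a + -1ℤ * (i * a) + + 2 * (a * d)
    expand = solve-∀

-- The graph is regular: the neighbourhood size `d` comes from `∑₂∩χ` with the empty set for `B`,
-- where all signs are 1.
γsR-Kneser₂-≥2 : ∀ n → 3 ℕ.≤ n → + 2 ≤ γsR (Kneser₂ n)
γsR-Kneser₂-≥2 n@(suc (suc (suc m))) (s≤s (s≤s (s≤s _))) =
  γsR-≥ (Kneser₂ n) (regular-weight-bound (Kneser₂ n) d regular edge d<V)
  where
  open FiniteSimpleGraph (Kneser₂ n)
  V d : ℤ
  V = weight (Kneser₂ n) (const +1ᴸ)
  d = V - (+ n * + 2 - + 2) + + 2
  edge : Vertex
  edge = inside ∷ inside ∷ ⊥ , cong (suc ∘ suc) (∣⊥∣≡0 (suc m))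
  ∣p∩⊥∣≡0 : (p : Subset n) → ∣ p ∩ ⊥ ∣ ≡ 0
  ∣p∩⊥∣≡0 p = trans (cong ∣_∣ (∩-zeroʳ p)) (∣⊥∣≡0 n)
  regular : ∀ v → closedNeighbourhoodSum (Kneser₂ n) (const +1ᴸ) v ≡ d
  regular v@(p , ∣p∣≡2) = trans (closedNeighbourhoodSum-Kneser (const +1ᴸ) v)
    (cong (λ z → V - z + + 2) (begin
      sum (λ u → + ∣ proj₁ u ∩ p ∣ * 1ℤ) vertices
        -- The constant label 1 is rewritten as the value of `χ ⊥`.
        ≡⟨ ∑-cong {n} {2} (λ q → cong (λ z → + ∣ q ∩ p ∣ * -1ℤ ^ z) (sym (∣p∩⊥∣≡0 q))) ⟩
      ∑ n 2 (λ q → + ∣ q ∩ p ∣ * χ ⊥ q)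
        ≡⟨ ∑₂∩χ ⊥ p ⟩
      bias (⊥ {n}) * biasOn ⊥ p - + ∣ p ∣
        ≡⟨ cong₂ _-_ (cong₂ _*_
             (trans (cong (λ z → + n - + 2 * + z) (∣⊥∣≡0 n)) (ℤ.+-identityʳ (+ n)))
             (cong₂ (λ x y → + x - + 2 * + y) ∣p∣≡2 (∣p∩⊥∣≡0 p))) (cong +_ ∣p∣≡2) ⟩
      + n * + 2 - + 2 ∎))
    where open ≡-Reasoning
  -- With n = 3 + m, the number of non-neighbours of a vertex is 2n - 4 = 2 + 2m, hence positive.
  gap : ∀ V m → V ≡ V - ((+ 3 + m) * + 2 - + 2) + + 2 + (+ 2 + (m + m))
  gap = solve-∀
  d<V : d < V
  d<V = subst (d <_) (sym (gap V (+ m)))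
    (subst (_< d + (+ 2 + (+ m + + m))) (ℤ.+-identityʳ d) (ℤ.+-monoʳ-< d {0ℤ} {+ 2 + (+ m + + m)} (+<+ (s≤s z≤n))))

-- Labellings from a cycle

-- The label with value (-1)^t. A 2-set meets `B` in t ≤ 2 points, so the default matters only at t
-- = 0 and t = 2.
sign : ℕ → Label
sign 1 = −1ᴸ
sign _ = +1ᴸ

⟦sign⟧ : ∀ {t} → t ℕ.≤ 2 → ⟦ sign t ⟧ ≡ -1ℤ ^ t
⟦sign⟧ {0} _ = refl
⟦sign⟧ {1} _ = refl
⟦sign⟧ {2} _ = refl
⟦sign⟧ {suc (suc (suc _))} (s≤s (s≤s ()))

-- If no value is 0, each is at least 1. This is used to find an edge of the cycle disjoint from a
-- given vertex.
∃0⊎length≤sum : ∀ {A : Set} (g : A → ℕ) xs → (∃ λ x → x ∈ xs × g x ≡ 0) ⊎ + length xs ≤ sum (+_ ∘ g) xs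
∃0⊎length≤sum g []       = inj₂ ℤ.≤-refl
∃0⊎length≤sum g (x ∷ xs) with g x in eq
... | 0     = inj₁ (x , here refl , eq)
... | suc m with ∃0⊎length≤sum g xs
...   | inj₁ (y , y∈xs , gy≡0) = inj₁ (y , there y∈xs , gy≡0)
...   | inj₂ len≤sum           = inj₂ (ℤ.+-mono-≤ (+≤+ (s≤s z≤n)) len≤sum)

-- The parameter c = 3 + j is the bias of B, and by ∑₂χ the hypothesis H-size says
-- that the labelling below has weight 2c − 3.
module Construction {n : ℕ} (B : Subset n) {H : List (SubsetOfSize n 2)}
  (H-unique : Unique H)
  (H⊆B      : All (λ h → ∣ proj₁ h ∩ B ∣ ≡ 2) H)
  -- The left side adds up the degrees in `H` of the points of `p`: degrees are at most 2 on `B` and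
  -- 0 off `B`.
  (H-degree : ∀ p → sum (λ h → + ∣ proj₁ h ∩ p ∣) H ≤ + 2 * + ∣ p ∩ B ∣)
  (3≤∣H∣    : 3 ℕ.≤ length H)
  (j        : ℕ)
  (B-bias   : bias B ≡ + (3 ℕ.+ j))
  (H-size   : + (3 ℕ.+ j) * + (3 ℕ.+ j) + + 2 * + length H ≡ + 2 * (+ 2 * + (3 ℕ.+ j) - + 3) + + n)
  where
  open FiniteSimpleGraph (Kneser₂ n)
  open DecMembership _≟_ using (_∈?_)

  label : Vertex → Label
  label v with v ∈? H
  ... | yes _ = +2ᴸ
  ... | no  _ = sign ∣ proj₁ v ∩ B ∣

  c : ℤ
  c = + (3 ℕ.+ j)

  ∣v∩B∣≤2 : ∀ (v : Vertex) → ∣ proj₁ v ∩ B ∣ ℕ.≤ 2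
  ∣v∩B∣≤2 (p , ∣p∣≡2) = subst (∣ p ∩ B ∣ ℕ.≤_) ∣p∣≡2 (∣p∩q∣≤∣p∣ p B)

  -- An edge of `H` lies inside `B`, so `χ B` is 1 there and the indicator raises it to 2.
  ⟦label⟧ : ∀ v → ⟦ label v ⟧ ≡ χ B (proj₁ v) + 1ℤ * 𝟙 (v ∈? H)
  ⟦label⟧ v with v ∈? H
  ... | yes v∈H = sym (cong (λ t → -1ℤ ^ t + 1ℤ) (All.lookup H⊆B v∈H))
  ... | no  _   = trans (⟦sign⟧ (∣v∩B∣≤2 v)) (sym (ℤ.+-identityʳ _))

  label-H : ∀ {v} → v ∈ H → label v ≡ +2ᴸ
  label-H {v} v∈H with v ∈? H
  ... | yes _   = refl
  ... | no  v∉H = contradiction v∈H v∉H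

  label-−1 : ∀ v → label v ≡ −1ᴸ → ∣ proj₁ v ∩ B ∣ ≡ 1
  label-−1 v lv≡−1 with v ∈? H
  label-−1 v ()    | yes _
  label-−1 v lv≡−1 | no _ with ∣ proj₁ v ∩ B ∣
  label-−1 v ()    | no _ | 0
  label-−1 v _     | no _ | 1 = refl
  label-−1 v ()    | no _ | suc (suc _)

  χ≤label : ∀ v → χ B (proj₁ v) ≤ ⟦ label v ⟧
  χ≤label v = subst₂ _≤_ (ℤ.+-identityʳ _) (sym (⟦label⟧ v)) (ℤ.+-monoʳ-≤ (χ B (proj₁ v)) (𝟙-nonNeg (v ∈? H)))
    where
    𝟙-nonNeg : ∀ {A : Set} (a? : Dec A) → 0ℤ ≤ 1ℤ * 𝟙 a?
    𝟙-nonNeg (yes _) = +≤+ z≤n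
    𝟙-nonNeg (no _)  = +≤+ z≤n

  sum-label : ∀ (g : Vertex → ℤ) → sum (λ u → g u * ⟦ label u ⟧) vertices ≡
              sum (λ u → g u * χ B (proj₁ u)) vertices + sum g H
  sum-label g = begin
    sum (λ u → g u * ⟦ label u ⟧) vertices
      ≡⟨ sum-cong (λ u → trans (cong (g u *_) (⟦label⟧ u)) (expand (g u) (χ B (proj₁ u)) (𝟙 (u ∈? H)))) vertices ⟩
    sum (λ u → g u * χ B (proj₁ u) + g u * 𝟙 (u ∈? H)) vertices
      ≡⟨ sum-+ (λ u → g u * χ B (proj₁ u)) (λ u → g u * 𝟙 (u ∈? H)) vertices ⟩
    sum (λ u → g u * χ B (proj₁ u)) vertices + sum (λ u → g u * 𝟙 (u ∈? H)) vertices
      ≡⟨ cong (λ z → sum (λ u → g u * χ B (proj₁ u)) vertices + z) (sum-∈ _≟_ g unique enumerates H-unique) ⟩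
    sum (λ u → g u * χ B (proj₁ u)) vertices + sum g H ∎
    where
    open ≡-Reasoning
    expand : ∀ a x y → a * (x + 1ℤ * y) ≡ a * x + a * y
    expand = solve-∀

  weight-label : weight (Kneser₂ n) label ≡ + 2 * c - + 3
  -- Both sides are doubled and increased by n to reach the division-free form of `∑₂χ`.
  weight-label = ℤ.*-cancelˡ-≡ (+ 2) _ _ (+-cancelʳ (+ n) _ _ (begin
    + 2 * weight (Kneser₂ n) label + + n
      ≡⟨ cong (λ z → + 2 * z + + n) W≡K+∣H∣ ⟩
    + 2 * (K + + length H) + + n
      ≡⟨ regroup K (+ length H) (+ n) ⟩
    + 2 * K + + n + + 2 * + length H
      ≡⟨ cong (λ z → z + + 2 * + length H) (trans (∑₂χ B) (cong (λ z → z * z) B-bias)) ⟩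
    c * c + + 2 * + length H
      ≡⟨ H-size ⟩
    + 2 * (+ 2 * c - + 3) + + n ∎))
    where
    open ≡-Reasoning
    K : ℤ
    K = ∑ n 2 (χ B)
    regroup : ∀ K h m → + 2 * (K + h) + m ≡ + 2 * K + m + + 2 * h
    regroup = solve-∀
    W≡K+∣H∣ : weight (Kneser₂ n) label ≡ K + + length H
    W≡K+∣H∣ = trans (sum-cong (λ u → sym (ℤ.*-identityˡ ⟦ label u ⟧)) vertices)
      (trans (sum-label (const 1ℤ))
        (cong₂ _+_ (∑-cong {n} {2} (λ q → ℤ.*-identityˡ (χ B q))) (sum-const-1 H)))

  -- Grouped so that the last bracket is nonnegative by `H-degree`; the rest depends only on t and
  -- the label of v, and is bounded by `1≤main-term`.
  closedNeighbourhoodSum-label : ∀ v → let t = ∣ proj₁ v ∩ B ∣ in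
    closedNeighbourhoodSum (Kneser₂ n) label v ≡
    + 2 * (c - 1ℤ) * + t - 1ℤ + + 2 * ⟦ label v ⟧ + (+ 2 * + t - sum (λ h → + ∣ proj₁ h ∩ proj₁ v ∣) H)
  closedNeighbourhoodSum-label v@(p , ∣p∣≡2) = begin
    closedNeighbourhoodSum (Kneser₂ n) label v
      ≡⟨ closedNeighbourhoodSum-Kneser label v ⟩
    weight (Kneser₂ n) label - sum (λ u → + ∣ proj₁ u ∩ p ∣ * ⟦ label u ⟧) vertices + + 2 * ⟦ label v ⟧
      ≡⟨ cong₂ (λ x y → x - y + + 2 * ⟦ label v ⟧) weight-label
           (trans (sum-label (λ u → + ∣ proj₁ u ∩ p ∣)) (cong (λ z → z + D)
             (trans (∑₂∩χ B p) (cong₂ (λ x y → x * (+ y - + 2 * + t) - + y) B-bias ∣p∣≡2)))) ⟩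
    + 2 * c - + 3 - (c * (+ 2 - + 2 * + t) - + 2 + D) + + 2 * ⟦ label v ⟧
      ≡⟨ regroup c (+ t) D ⟦ label v ⟧ ⟩
    + 2 * (c - 1ℤ) * + t - 1ℤ + + 2 * ⟦ label v ⟧ + (+ 2 * + t - D) ∎
    where
    open ≡-Reasoning
    t : ℕ
    t = ∣ p ∩ B ∣
    D : ℤ
    D = sum (λ h → + ∣ proj₁ h ∩ p ∣) H
    regroup : ∀ c t D l → + 2 * c - + 3 - (c * (+ 2 - + 2 * t) - + 2 + D) + + 2 * l ≡
                          + 2 * (c - 1ℤ) * t - 1ℤ + + 2 * l + (+ 2 * t - D)
    regroup = solve-∀

  -- The values at t = 0, 1, 2 are 1, 2c - 5 and 4c - 3. The middle one is where c ≥ 3 enters.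
  1≤main-term : ∀ {t} → t ℕ.≤ 2 → 1ℤ ≤ + 2 * (c - 1ℤ) * + t - 1ℤ + + 2 * -1ℤ ^ t
  1≤main-term {0} _ = subst (1ℤ ≤_) (sym (at-0 (+ j))) ℤ.≤-refl
    where
    at-0 : ∀ j → + 2 * (+ 3 + j - 1ℤ) * 0ℤ - 1ℤ + + 2 ≡ 1ℤ
    at-0 = solve-∀
  1≤main-term {1} _ = subst (1ℤ ≤_) (sym (at-1 (+ j))) (+≤+ (s≤s z≤n))
    where
    at-1 : ∀ j → + 2 * (+ 3 + j - 1ℤ) * 1ℤ - 1ℤ - + 2 ≡ 1ℤ + (j + j)
    at-1 = solve-∀
  1≤main-term {2} _ = subst (1ℤ ≤_) (sym (at-2 (+ j))) (+≤+ (s≤s z≤n))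
    where
    at-2 : ∀ j → + 2 * (+ 3 + j - 1ℤ) * + 2 - 1ℤ + + 2 ≡ + 9 + (j + j + (j + j))
    at-2 = solve-∀
  1≤main-term {suc (suc (suc _))} (s≤s (s≤s ()))

  isSRDF-label : IsSRDF (Kneser₂ n) label
  isSRDF-label = isSRDF defended positive
    where
    defended : ∀ v → label v ≡ −1ᴸ → ∃ λ u → Adj v u × label u ≡ +2ᴸ
    -- A vertex labelled -1 has one point in `B`, so its points have total degree at most 2 in `H`.
    -- As `H` has at least 3 edges, one of them misses the vertex.
    defended v@(p , _) lv≡−1 with ∃0⊎length≤sum (λ h → ∣ proj₁ h ∩ p ∣) H
    ... | inj₁ (h , h∈H , ∣h∩p∣≡0) =
      h , subst Empty (∩-comm (proj₁ h) p) (∣∣≡0⇒Empty ∣h∩p∣≡0) , label-H h∈H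
    ... | inj₂ ∣H∣≤sum = contradiction (ℤ.≤-trans (+≤+ 3≤∣H∣) (ℤ.≤-trans ∣H∣≤sum
      (subst (λ t → _ ≤ + 2 * + t) (label-−1 v lv≡−1) (H-degree p)))) λ { (+≤+ (s≤s (s≤s ()))) }
    positive : ∀ v → 1ℤ ≤ closedNeighbourhoodSum (Kneser₂ n) label v
    positive v@(p , _) = subst (1ℤ ≤_) (sym (closedNeighbourhoodSum-label v))
      (ℤ.+-mono-≤ {1ℤ} {_} {0ℤ}
        -- The label is replaced by the smaller value `χ B`, a function of t alone.
        (ℤ.≤-trans (1≤main-term (∣v∩B∣≤2 v)) (ℤ.+-monoʳ-≤ (+ 2 * (c - 1ℤ) * + ∣ p ∩ B ∣ - 1ℤ) (ℤ.*-monoˡ-≤-nonNeg (+ 2) (χ≤label v))))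
        (ℤ.i≤j⇒0≤j-i (H-degree p)))

  γsR-≤-2c-3 : γsR (Kneser₂ n) ≤ + 2 * c - + 3
  γsR-≤-2c-3 = γsR-≤ (Kneser₂ n) (label , isSRDF-label , weight-label)

-- Cycles on an initial segment of the points

-- This serves as `B`: the k + 2 cycle points, followed by `t` for points of `B` off the cycle. By
-- computation `core (suc k) t` is `inside ∷ core k t`, which drives the inductions on k.
core : ∀ k {r} → Subset r → Subset (suc (suc k) ℕ.+ r)
core k t = inside ∷ inside ∷ (Vec.replicate k inside Vec.++ t)

edge₀₁ : ∀ r → SubsetOfSize (suc (suc r)) 2
edge₀₁ r = inside ∷ inside ∷ ⊥ , cong (suc ∘ suc) (∣⊥∣≡0 r)

edge₀₂ : ∀ r → SubsetOfSize (suc (suc (suc r))) 2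
edge₀₂ r = inside ∷ outside ∷ inside ∷ ⊥ , cong (suc ∘ suc) (∣⊥∣≡0 r)

-- In cycle k the edge {0,1} closes a path 0, 2, 4, …, 5, 3, 1 on k + 2 points.
-- Passing to k + 1 shifts the points up and replaces the old edge {0,1}, now {1,2},
-- by {0,1} and {0,2}, so that it subdivides an edge by the new point 0.
-- For k = 0 the path is the edge {0,1} itself, a doubled edge in cycle 0.
path : ∀ k r → List (SubsetOfSize (suc (suc k) ℕ.+ r) 2)
path zero    r = edge₀₁ r ∷ []
path (suc k) r = edge₀₂ (k ℕ.+ r) ∷ map addOutside (path k r)

cycle : ∀ k r → List (SubsetOfSize (suc (suc k) ℕ.+ r) 2)
cycle k r = edge₀₁ (k ℕ.+ r) ∷ path k r

length-path : ∀ k r → length (path k r) ≡ suc k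
length-path zero    r = refl
length-path (suc k) r = cong suc (trans (length-map addOutside (path k r)) (length-path k r))

∉-map-addOutside : ∀ {n k p ∣p∣≡} (qs : List (SubsetOfSize n (suc k))) →
                   All ((inside ∷ p , ∣p∣≡) ≢_) (map addOutside qs)
∉-map-addOutside qs = All.map⁺ (All.tabulate λ _ ())

path-unique : ∀ k r → Unique (path k r)
path-unique zero    r = [] ∷ []
path-unique (suc k) r = ∉-map-addOutside (path k r) ∷
  Unique.map⁺ (SubsetOfSize-≡ ∘ Vec.∷-injectiveʳ ∘ cong proj₁) (path-unique k r)

-- Starting at `suc k` excludes the doubled edge of `cycle 0`. The edge {0,1} differs from {0,2},
-- and all shifted edges avoid 0.
cycle-unique : ∀ k r → Unique (cycle (suc k) r)
cycle-unique k r = ((λ ()) ∷ ∉-map-addOutside (path k r)) ∷ path-unique (suc k) r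

edge₀₁-∩ : ∀ {r} x y (p : Subset r) → + ∣ proj₁ (edge₀₁ r) ∩ (x ∷ y ∷ p) ∣ ≡ κ x + κ y
edge₀₁-∩ x y p = trans (∣∷∣ x (y ∷ ⊥ ∩ p)) (cong (λ z → κ x + z)
  (trans (∣∷∣ y (⊥ ∩ p)) (trans (cong (λ z → κ y + + z) (∣⊥∩p∣≡0 p)) (ℤ.+-identityʳ (κ y)))))

edge₀₂-∩ : ∀ {r} x y z (p : Subset r) → + ∣ proj₁ (edge₀₂ r) ∩ (x ∷ y ∷ z ∷ p) ∣ ≡ κ x + κ z
edge₀₂-∩ x y z p = trans (∣∷∣ x (outside ∷ z ∷ ⊥ ∩ p)) (cong (λ w → κ x + w)
  (trans (∣∷∣ z (⊥ ∩ p)) (trans (cong (λ w → κ z + + w) (∣⊥∩p∣≡0 p)) (ℤ.+-identityʳ (κ z)))))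

∩-∷-inside : ∀ {n} x (p q : Subset n) → + ∣ (x ∷ p) ∩ (inside ∷ q) ∣ ≡ κ x + + ∣ p ∩ q ∣
∩-∷-inside inside  p q = refl
∩-∷-inside outside p q = refl

path⊆core : ∀ k {r} (t : Subset r) → All (λ h → ∣ proj₁ h ∩ core k t ∣ ≡ 2) (path k r)
path⊆core zero          t = cong (suc ∘ suc) (∣⊥∩p∣≡0 t) ∷ []
path⊆core (suc k) {r} t = cong (suc ∘ suc) (∣⊥∩p∣≡0 (Vec.replicate k inside Vec.++ t)) ∷
                          All.map⁺ (path⊆core k t)

-- The term κ x + κ y is the contribution of the edge {0,1} closing the cycle.
path-degree : ∀ k {r} (t : Subset r) x y p →
  sum (λ h → + ∣ proj₁ h ∩ (x ∷ y ∷ p) ∣) (path k r) + (κ x + κ y) ≤ + 2 * + ∣ (x ∷ y ∷ p) ∩ core k t ∣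
path-degree zero t x y p = begin
  + ∣ proj₁ (edge₀₁ _) ∩ (x ∷ y ∷ p) ∣ + 0ℤ + (κ x + κ y)
    ≡⟨ cong (λ z → z + 0ℤ + (κ x + κ y)) (edge₀₁-∩ x y p) ⟩
  κ x + κ y + 0ℤ + (κ x + κ y)
    ≡⟨ double (κ x) (κ y) ⟩
  + 2 * (κ x + (κ y + 0ℤ))
    -- Points of `t` lie on no edge; their share of the right side is bounded below by 0.
    ≤⟨ ℤ.*-monoˡ-≤-nonNeg (+ 2) (ℤ.+-monoʳ-≤ (κ x) (ℤ.+-monoʳ-≤ (κ y) (+≤+ z≤n))) ⟩
  + 2 * (κ x + (κ y + + ∣ p ∩ t ∣))
    ≡⟨ cong (+ 2 *_) (trans (∩-∷-inside x (y ∷ p) (inside ∷ t)) (cong (λ z → κ x + z) (∩-∷-inside y p t))) ⟨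
  + 2 * + ∣ (x ∷ y ∷ p) ∩ core zero t ∣ ∎
  where
  open ℤ.≤-Reasoning
  double : ∀ x y → x + y + 0ℤ + (x + y) ≡ + 2 * (x + (y + 0ℤ))
  double = solve-∀
path-degree (suc k) {r} t x y (z ∷ p) = begin
  + ∣ proj₁ (edge₀₂ _) ∩ (x ∷ y ∷ z ∷ p) ∣ + sum g (map addOutside (path k r)) + (κ x + κ y)
    ≡⟨ cong₂ (λ a b → a + b + (κ x + κ y)) (edge₀₂-∩ x y z p) (sum-map g addOutside (path k r)) ⟩
  κ x + κ z + S + (κ x + κ y)
    -- The new point has degree 2, and κ y + κ z is the closing edge of the smaller cycle, as the
    -- induction hypothesis requires.
    ≡⟨ regroup (κ x) (κ y) (κ z) S ⟩
  + 2 * κ x + (S + (κ y + κ z))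
    ≤⟨ ℤ.+-monoʳ-≤ (+ 2 * κ x) (path-degree k t y z p) ⟩
  + 2 * κ x + + 2 * + ∣ (y ∷ z ∷ p) ∩ core k t ∣
    ≡⟨ ℤ.*-distribˡ-+ (+ 2) (κ x) (+ ∣ (y ∷ z ∷ p) ∩ core k t ∣) ⟨
  + 2 * (κ x + + ∣ (y ∷ z ∷ p) ∩ core k t ∣)
    ≡⟨ cong (+ 2 *_) (∩-∷-inside x (y ∷ z ∷ p) (core k t)) ⟨
  + 2 * + ∣ (x ∷ y ∷ z ∷ p) ∩ core (suc k) t ∣ ∎
  where
  open ℤ.≤-Reasoning
  g : SubsetOfSize (suc (suc (suc k)) ℕ.+ r) 2 → ℤ
  g h = + ∣ proj₁ h ∩ (x ∷ y ∷ z ∷ p) ∣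
  S : ℤ
  S = sum (λ h → + ∣ proj₁ h ∩ (y ∷ z ∷ p) ∣) (path k r)
  regroup : ∀ x y z S → x + z + S + (x + y) ≡ + 2 * x + (S + (y + z))
  regroup = solve-∀

cycle-degree : ∀ k {r} (t : Subset r) p →
  sum (λ h → + ∣ proj₁ h ∩ p ∣) (cycle k r) ≤ + 2 * + ∣ p ∩ core k t ∣
cycle-degree k {r} t (x ∷ y ∷ p) = subst (_≤ + 2 * + ∣ (x ∷ y ∷ p) ∩ core k t ∣)
  (trans (ℤ.+-comm S _) (cong (_+ S) (sym (edge₀₁-∩ x y p))))
  (path-degree k t x y p)
  where
  S : ℤ
  S = sum (λ h → + ∣ proj₁ h ∩ (x ∷ y ∷ p) ∣) (path k r)

cycle⊆core : ∀ k {r} (t : Subset r) → All (λ h → ∣ proj₁ h ∩ core k t ∣ ≡ 2) (cycle k r)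
cycle⊆core k t = cong (suc ∘ suc) (∣⊥∩p∣≡0 (Vec.replicate k inside Vec.++ t)) ∷ path⊆core k t

bias-core : ∀ k {r} (t : Subset r) → bias (core k t) ≡ bias t - (+ 2 + + k)
bias-core zero t = trans (bias-∷ inside (inside ∷ t))
  (trans (cong (λ z → -1ℤ + z) (bias-∷ inside t)) (regroup (bias t)))
  where
  regroup : ∀ b → -1ℤ + (-1ℤ + b) ≡ b - (+ 2 + 0ℤ)
  regroup = solve-∀
bias-core (suc k) t = trans (bias-∷ inside (core k t))
  (trans (cong (λ z → -1ℤ + z) (bias-core k t)) (regroup (bias t) (+ k)))
  where
  regroup : ∀ b k → -1ℤ + (b - (+ 2 + k)) ≡ b - (+ 2 + (1ℤ + k))
  regroup = solve-∀

-- Upper bounds in the two parities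

bias-⊥ : ∀ n → bias (⊥ {n}) ≡ + n
bias-⊥ n = trans (cong (λ z → + n - + 2 * + z) (∣⊥∣≡0 n)) (ℤ.+-identityʳ (+ n))

-- Here n = 2k + 9, and `B` consists of the k + 3 cycle points, so c = 3 and 2c - 3 = 3.
γsR-≤-odd : ∀ k → γsR (Kneser₂ (suc (suc (suc k)) ℕ.+ (5 ℕ.+ suc k))) ≤ + 3
γsR-≤-odd k = Construction.γsR-≤-2c-3 (core (suc k) ⊥) (cycle-unique k (6 ℕ.+ k)) (cycle⊆core (suc k) ⊥)
  (cycle-degree (suc k) ⊥) (subst (3 ℕ.≤_) (sym length≡) (ℕ.m≤m+n 3 k)) 0
  (trans (bias-core (suc k) (⊥ {6 ℕ.+ k})) (trans (cong (_- (+ 3 + + k)) (bias-⊥ (6 ℕ.+ k))) (bias≡3 (+ k))))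
  (trans (cong (λ h → + 3 * + 3 + + 2 * + h) length≡) (size (+ k)))
  where
  length≡ : length (cycle (suc k) (6 ℕ.+ k)) ≡ 3 ℕ.+ k
  length≡ = cong suc (length-path (suc k) (6 ℕ.+ k))
  bias≡3 : ∀ k → + 6 + k - (+ 3 + k) ≡ + 3
  bias≡3 = solve-∀
  size : ∀ k → + 3 * + 3 + + 2 * (+ 3 + k) ≡ + 2 * (+ 2 * + 3 - + 3) + (+ 3 + (k + (+ 6 + k)))
  size = solve-∀

γsR-≤-even : ∀ k → γsR (Kneser₂ (suc (suc (suc k)) ℕ.+ (8 ℕ.+ suc k))) ≤ + 5
γsR-≤-even k = Construction.γsR-≤-2c-3 (core (suc k) t) (cycle-unique k (9 ℕ.+ k)) (cycle⊆core (suc k) t)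
  (cycle-degree (suc k) t) (subst (3 ℕ.≤_) (sym length≡) (ℕ.m≤m+n 3 k)) 1
  (trans (bias-core (suc k) t) (trans (cong (_- (+ 3 + + k)) bias-t) (bias≡4 (+ k))))
  (trans (cong (λ h → + 4 * + 4 + + 2 * + h) length≡) (size (+ k)))
  where
  -- Here n = 2k + 12. With c = 4, `H-size` forces k + 3 edges while the bias forces k + 4 points in
  -- `B`, so one point of `B` stays off the cycle.
  t : Subset (9 ℕ.+ k)
  t = inside ∷ ⊥
  bias-t : bias t ≡ + 7 + + k
  bias-t = trans (bias-∷ inside (⊥ {8 ℕ.+ k})) (cong (λ z → -1ℤ + z) (bias-⊥ (8 ℕ.+ k)))
  length≡ : length (cycle (suc k) (9 ℕ.+ k)) ≡ 3 ℕ.+ k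
  length≡ = cong suc (length-path (suc k) (9 ℕ.+ k))
  bias≡4 : ∀ k → + 7 + k - (+ 3 + k) ≡ + 4
  bias≡4 = solve-∀
  size : ∀ k → + 4 * + 4 + + 2 * (+ 3 + k) ≡ + 2 * (+ 2 * + 4 - + 3) + (+ 3 + (k + (+ 9 + k)))
  size = solve-∀

even⊎odd : ∀ n → 2 ∣ n ⊎ ∃ λ m → n ≡ suc (m ℕ.* 2)
even⊎odd zero    = inj₁ (divides 0 refl)
even⊎odd (suc n) with even⊎odd n
... | inj₁ (divides m n≡m*2) = inj₂ (m , cong suc n≡m*2)
... | inj₂ (m , n≡1+m*2)     = inj₁ (divides (suc m) (cong suc n≡1+m*2))

γsR-≤3 : ∀ n → 12 ℕ.≤ n → 2 ∤ n → γsR (Kneser₂ n) ≤ + 3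
γsR-≤3 n 12≤n 2∤n with even⊎odd n
... | inj₁ 2∣n        = contradiction 2∣n 2∤n
-- The bound 11 ≤ 2m is weakened to 4 * 2 ≤ m * 2, which gives m = 4 + k and n = 2k + 9.
... | inj₂ (m , refl) with ℕ.m≤n⇒∃[o]m+o≡n (ℕ.*-cancelʳ-≤ 4 m 2 (ℕ.≤-trans (ℕ.m≤m+n 8 3) (ℕ.s≤s⁻¹ 12≤n)))
...   | k , refl = subst (λ n → γsR (Kneser₂ n) ≤ + 3) (split k) (γsR-≤-odd k)
  where
  split : ∀ k → 3 ℕ.+ (k ℕ.+ (6 ℕ.+ k)) ≡ 1 ℕ.+ (4 ℕ.+ k) ℕ.* 2
  split = ℕ-Solver.solve-∀

γsR-≤5 : ∀ n → 12 ℕ.≤ n → 2 ∣ n → γsR (Kneser₂ n) ≤ + 5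
-- From 6 * 2 ≤ q * 2 comes q = 6 + k; the case k = 0 uses a triangle.
γsR-≤5 n 12≤n (divides q refl) with ℕ.m≤n⇒∃[o]m+o≡n (ℕ.*-cancelʳ-≤ 6 q 2 12≤n)
... | k , refl = subst (λ n → γsR (Kneser₂ n) ≤ + 5) (split k) (γsR-≤-even k)
  where
  split : ∀ k → 3 ℕ.+ (k ℕ.+ (9 ℕ.+ k)) ≡ (6 ℕ.+ k) ℕ.* 2
  split = ℕ-Solver.solve-∀

theorem3 : (n : ℕ) → 12 ℕ.≤ n →
    (2 ∤ n → + 2 ≤ γsR (Kneser₂ n) × γsR (Kneser₂ n) ≤ + 3) ×
    (2 ∣ n → + 2 ≤ γsR (Kneser₂ n) × γsR (Kneser₂ n) ≤ + 5)
theorem3 n 12≤n = (λ 2∤n → lower , γsR-≤3 n 12≤n 2∤n) , (λ 2∣n → lower , γsR-≤5 n 12≤n 2∣n)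
  where
  lower : + 2 ≤ γsR (Kneser₂ n)
  lower = γsR-Kneser₂-≥2 n (ℕ.≤-trans (ℕ.m≤m+n 3 9) 12≤n)
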